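{- For any fixed $i,j\in\{0,1,2\}$, one has $\displaystyle\sum_{k=0}^{2}\sum_{\ell=0}^{2}W_{y/x}(i,j;k,\ell)=1$.
   Context: For $i,j,k,\ell\in\{0,1,2\}$ the Izergin--Korepin vertex weight $W_{y/x}(i,j;k,\ell)$ is a rational function of $q$ and $y/x$ which, with $D=(x-q^2y)(x-q^3y)$, is given by $W(0,0;0,0)=W(2,2;2,2)=1$; $W(1,0;1,0)=W(2,1;2,1)=\frac{q^2(x-y)}{x-q^2y}$; $W(1,0;0,1)=W(2,1;1,2)=\frac{(1-q^2)x}{x-q^2y}$; $W(0,1;1,0)=W(1,2;2,1)=\frac{(1-q^2)y}{x-q^2y}$; $W(0,1;0,1)=W(1,2;1,2)=\frac{x-y}{x-q^2y}$; $W(2,0;2,0)=\frac{q^4(x-y)(x-qy)}{D}$; $W(2,0;1,1)=-\frac{q(1-q)^2(1+q)x(x-y)}{D}$; $W(2,0;0,2)=\frac{(1-q^2)x(x+qx-qy-q^3y)}{D}$; $W(1,1;2,0)=-\frac{q^4(1+q)(x-y)y}{D}$; $W(1,1;1,1)=\frac{ -qx^2+(1+q)(1-q^2+q^4)xy-q^4y^2}{D}$; $W(1,1;0,2)=\frac{(1+q)x(x-y)}{D}$; $W(0,2;2,0)=\frac{(1-q^2)(x+q^2x-q^2y-q^3y)y}{D}$; $W(0,2;1,1)=\frac{q(1-q)^2(1+q)(x-y)y}{D}$; $W(0,2;0,2)=\frac{(x-y)(x-qy)}{D}$; and $W=0$ in all other cases. -}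

module Defs where

open import Algebra.Apartness.Bundles using (HeytingCommutativeRing; HeytingField)
open import Algebra.Bundles using (CommutativeRing)
open import Data.Fin.Base using (Fin)
open import Data.Fin.Patterns using (0F; 1F; 2F)
open import Data.Product.Base using (∃-syntax; _,_; proj₁)
import Algebra.Apartness.Properties.HeytingCommutativeRing as HeytingProperties
import Algebra.Properties.CommutativeMonoid.Sum as Sum
import Algebra.Properties.Semiring.Exp as Exp

module IzerginKorepin {c ℓ₁ ℓ₂} (K : HeytingField c ℓ₁ ℓ₂) where

  open HeytingField K
  open HeytingProperties heytingCommutativeRing using (x#0y#0→xy#0)
  open CommutativeRing (HeytingCommutativeRing.commutativeRing heytingCommutativeRing)
    using (semiring; +-commutativeMonoid)
  open Exp semiring public using (_^_)
  open Sum +-commutativeMonoid public using (sum-syntax)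

  infixl 7 _/_

  -- `#⇒invertible d#0` inverts `d - 0#`, which is `d` up to `_≈_`.
  _/_ : Carrier → (∃[ d ] d # 0#) → Carrier
  a / (_ , d#0) = a * proj₁ (#⇒invertible d#0)

  -- The weight W_{y/x}(i,j;k,ℓ), as a function of q, x and y wherever its
  -- denominators do not vanish.  Taking for K the field of rational functions
  -- in independent q, x, y gives the weights as formal rational functions.
  W : (q x y : Carrier) → x - q ^ 2 * y # 0# → x - q ^ 3 * y # 0# →
      (i j k ℓ : Fin 3) → Carrier
  W q x y x-q²y#0 x-q³y#0 = w
    where
    E D : ∃[ d ] d # 0#
    E = x - q ^ 2 * y , x-q²y#0
    D = (x - q ^ 2 * y) * (x - q ^ 3 * y) , x#0y#0→xy#0 x-q²y#0 x-q³y#0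

    w : (i j k ℓ : Fin 3) → Carrier
    w 0F 0F 0F 0F = 1#
    w 2F 2F 2F 2F = 1#
    w 1F 0F 1F 0F = q ^ 2 * (x - y) / E
    w 2F 1F 2F 1F = q ^ 2 * (x - y) / E
    w 1F 0F 0F 1F = (1# - q ^ 2) * x / E
    w 2F 1F 1F 2F = (1# - q ^ 2) * x / E
    w 0F 1F 1F 0F = (1# - q ^ 2) * y / E
    w 1F 2F 2F 1F = (1# - q ^ 2) * y / E
    w 0F 1F 0F 1F = (x - y) / E
    w 1F 2F 1F 2F = (x - y) / E
    w 2F 0F 2F 0F = q ^ 4 * (x - y) * (x - q * y) / D
    w 2F 0F 1F 1F = - (q * (1# - q) ^ 2 * (1# + q) * x * (x - y) / D)
    w 2F 0F 0F 2F = (1# - q ^ 2) * x * (x + q * x - q * y - q ^ 3 * y) / D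
    w 1F 1F 2F 0F = - (q ^ 4 * (1# + q) * (x - y) * y / D)
    w 1F 1F 1F 1F =
      (- (q * x ^ 2) + (1# + q) * (1# - q ^ 2 + q ^ 4) * x * y - q ^ 4 * y ^ 2) / D
    w 1F 1F 0F 2F = (1# + q) * x * (x - y) / D
    w 0F 2F 2F 0F =
      (1# - q ^ 2) * (x + q ^ 2 * x - q ^ 2 * y - q ^ 3 * y) * y / D
    w 0F 2F 1F 1F = q * (1# - q) ^ 2 * (1# + q) * (x - y) * y / D
    w 0F 2F 0F 2F = (x - y) * (x - q * y) / D
    w _  _  _  _  = 0#

{-# OPTIONS --safe #-}
module Submission where

-- Charge is conserved: W(i,j;k,ℓ) vanishes unless i + j = k + ℓ.  The double
-- sum therefore runs over one antidiagonal of the 3 × 3 square only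
-- (`∑-antidiagonal₁`, `∑-antidiagonal₂`, `∑-antidiagonal₃`), where it has at
-- most three terms.  If i + j is 0 or 4 there is one term, equal to 1.
-- Otherwise all terms have the same denominator, x - q²y if i + j is odd and
-- D = (x - q²y)(x - q³y) if i + j = 2, and in each case the numerators add up
-- to that denominator.  The latter is a polynomial identity with integer
-- coefficients in q, x and y; it is settled by comparing normal forms in
-- ℤ[q, x, y, t], with t standing for the inverse of the denominator.
--
-- The normaliser needs coefficients with decidable equality, which the field
-- does not have, so the canonical homomorphism from ℤ to a commutative ring
-- is constructed first.

open import Defs
open import Algebra.Apartness.Bundles using (HeytingCommutativeRing; HeytingField)
open import Algebra.Bundles using (CommutativeRing)
open import Algebra.Solver.Ring.AlmostCommutativeRing
  using (_-Raw-AlmostCommutative⟶_; fromCommutativeRing)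
open import Data.Fin.Base using (Fin)
open import Data.Fin.Patterns using (0F; 1F; 2F)
open import Data.Integer.Base as ℤ using (ℤ; +_; -[1+_]; +[1+_])
open import Data.Maybe.Base as Maybe using (Maybe)
open import Data.Nat.Base as ℕ using (ℕ; zero; suc)
open import Data.Product.Base using (_,_; proj₁; proj₂)
open import Relation.Binary.PropositionalEquality.Core as ≡ using (_≡_)
open import Relation.Nullary.Decidable.Core using (dec⇒maybe)
import Algebra.Apartness.Properties.HeytingCommutativeRing as HeytingProperties
import Algebra.Properties.AbelianGroup as AbelianGroupProperties
import Algebra.Properties.Ring as RingProperties
import Algebra.Properties.Semiring.Mult.TCOptimised as Mult
import Algebra.Solver.Ring
import Data.Integer.Properties as ℤ
import Data.Nat.Properties as ℕ
import Data.Vec.Functional as Vector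
import Relation.Binary.Reasoning.Setoid as SetoidReasoning

-- The canonical homomorphism from the integers

module IntegerCoefficients {c ℓ} (R : CommutativeRing c ℓ) where

  open CommutativeRing R
  open AbelianGroupProperties +-abelianGroup
    using () renaming (ε⁻¹≈ε to -0≈0; ⁻¹-involutive to -‿involutive; ⁻¹-∙-comm to -‿+-comm)
  open RingProperties ring using (-‿distribˡ-*; -‿distribʳ-*)
  open Mult semiring using (_×_; 1+×; ×-homo-+; ×1-homo-*)
  open SetoidReasoning setoid

  -- The image of an integer in R.  With this multiple, `1 × 1#` is `1#` by
  -- computation, so the constants 0 and 1 are sent to `0#` and `1#` exactly.
  fromℤ : ℤ → Carrier
  fromℤ (+ n)    = n × 1#
  fromℤ -[1+ n ] = - (suc n × 1#)

  fromℤ-cong : ∀ {i j} → i ≡ j → fromℤ i ≈ fromℤ j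
  fromℤ-cong ≡.refl = refl

  fromℤ-neg : ∀ i → fromℤ (ℤ.- i) ≈ - fromℤ i
  fromℤ-neg (+ zero) = sym -0≈0
  fromℤ-neg +[1+ n ] = refl
  fromℤ-neg -[1+ n ] = sym (-‿involutive _)

  +-cancel-diff : ∀ a b d → (d + a) - (d + b) ≈ a - b
  +-cancel-diff a b d = begin
    (d + a) - (d + b)       ≈⟨ +-cong (+-comm a d) (-‿+-comm d b) ⟨
    (a + d) + (- d + - b)   ≈⟨ +-assoc a d _ ⟩
    a + (d + (- d + - b))   ≈⟨ +-congˡ (+-assoc d (- d) (- b)) ⟨
    a + ((d + - d) + - b)   ≈⟨ +-congˡ (+-congʳ (-‿inverseʳ d)) ⟩
    a + (0# + - b)          ≈⟨ +-congˡ (+-identityˡ (- b)) ⟩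
    a - b                   ∎

  fromℤ-⊖ : ∀ m n → fromℤ (m ℤ.⊖ n) ≈ m × 1# - n × 1#
  fromℤ-⊖ m zero = begin
    m × 1#       ≈⟨ +-identityʳ _ ⟨
    m × 1# + 0#  ≈⟨ +-congˡ -0≈0 ⟨
    m × 1# - 0#  ∎
  fromℤ-⊖ zero    (suc n) = sym (+-identityˡ _)
  fromℤ-⊖ (suc m) (suc n) = begin
    fromℤ (suc m ℤ.⊖ suc n)           ≈⟨ fromℤ-cong (ℤ.[1+m]⊖[1+n]≡m⊖n m n) ⟩
    fromℤ (m ℤ.⊖ n)                   ≈⟨ fromℤ-⊖ m n ⟩
    m × 1# - n × 1#                   ≈⟨ +-cancel-diff _ _ 1# ⟨
    (1# + m × 1#) - (1# + n × 1#)     ≈⟨ +-cong (1+× m 1#) (-‿cong (1+× n 1#)) ⟨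
    suc m × 1# - suc n × 1#           ∎

  fromℤ-+ : ∀ i j → fromℤ (i ℤ.+ j) ≈ fromℤ i + fromℤ j
  fromℤ-+ (+ m)    (+ n)    = ×-homo-+ 1# m n
  fromℤ-+ (+ m)    -[1+ n ] = fromℤ-⊖ m (suc n)
  fromℤ-+ -[1+ m ] (+ n)    = trans (fromℤ-⊖ n (suc m)) (+-comm _ _)
  fromℤ-+ -[1+ m ] -[1+ n ] = begin
    - (suc (suc (m ℕ.+ n)) × 1#)        ≡⟨ ≡.cong (λ k → - (suc k × 1#)) (ℕ.+-suc m n) ⟨
    - ((suc m ℕ.+ suc n) × 1#)          ≈⟨ -‿cong (×-homo-+ 1# (suc m) (suc n)) ⟩
    - (suc m × 1# + suc n × 1#)         ≈⟨ -‿+-comm _ _ ⟨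
    - (suc m × 1#) + - (suc n × 1#)     ∎

  fromℤ-+* : ∀ m j → fromℤ (+ m ℤ.* j) ≈ m × 1# * fromℤ j
  fromℤ-+* m (+ n) = begin
    fromℤ (+ m ℤ.* + n)   ≈⟨ fromℤ-cong (ℤ.pos-* m n) ⟨
    (m ℕ.* n) × 1#        ≈⟨ ×1-homo-* m n ⟩
    m × 1# * n × 1#       ∎
  fromℤ-+* m -[1+ n ] = begin
    fromℤ (+ m ℤ.* -[1+ n ])         ≈⟨ fromℤ-cong (ℤ.neg-distribʳ-* (+ m) +[1+ n ]) ⟨
    fromℤ (ℤ.- (+ m ℤ.* +[1+ n ]))   ≈⟨ fromℤ-neg (+ m ℤ.* +[1+ n ]) ⟩
    - fromℤ (+ m ℤ.* +[1+ n ])       ≈⟨ -‿cong (fromℤ-+* m +[1+ n ]) ⟩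
    - (m × 1# * suc n × 1#)          ≈⟨ -‿distribʳ-* _ _ ⟩
    m × 1# * - (suc n × 1#)          ∎

  fromℤ-* : ∀ i j → fromℤ (i ℤ.* j) ≈ fromℤ i * fromℤ j
  fromℤ-* (+ m)    j = fromℤ-+* m j
  fromℤ-* -[1+ m ] j = begin
    fromℤ (-[1+ m ] ℤ.* j)           ≈⟨ fromℤ-cong (ℤ.neg-distribˡ-* +[1+ m ] j) ⟨
    fromℤ (ℤ.- (+[1+ m ] ℤ.* j))     ≈⟨ fromℤ-neg (+[1+ m ] ℤ.* j) ⟩
    - fromℤ (+[1+ m ] ℤ.* j)         ≈⟨ -‿cong (fromℤ-+* (suc m) j) ⟩
    - (suc m × 1# * fromℤ j)         ≈⟨ -‿distribˡ-* _ _ ⟩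
    - (suc m × 1#) * fromℤ j         ∎

  homomorphism : ℤ.+-*-rawRing -Raw-AlmostCommutative⟶ fromCommutativeRing R
  homomorphism = record
    { ⟦_⟧    = fromℤ
    ; +-homo = fromℤ-+
    ; *-homo = fromℤ-*
    ; -‿homo = fromℤ-neg
    ; 0-homo = refl
    ; 1-homo = refl
    }

  fromℤ≟ : ∀ i j → Maybe (fromℤ i ≈ fromℤ j)
  fromℤ≟ i j = Maybe.map fromℤ-cong (dec⇒maybe (i ℤ.≟ j))

  open Algebra.Solver.Ring _ _ homomorphism fromℤ≟ public
    using (Polynomial; con; _:+_; _:-_; _:*_; _:^_; :-_; _:=_; solve)

-- Sums over the antidiagonals of the 3 × 3 square

-- The function on the square with the given values on the antidiagonal
-- k + ℓ = 1, listed by increasing k, and the value o elsewhere; likewise for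
-- k + ℓ = 2 and k + ℓ = 3 below.  The codomain is arbitrary so that it can
-- consist of ring elements or of polynomial expressions.
antidiagonal₁ : ∀ {a} {A : Set a} (o u v : A) → Fin 3 → Fin 3 → A
antidiagonal₁ o u v 0F 1F = u
antidiagonal₁ o u v 1F 0F = v
antidiagonal₁ o u v _  _  = o

antidiagonal₂ : ∀ {a} {A : Set a} (o u v w : A) → Fin 3 → Fin 3 → A
antidiagonal₂ o u v w 0F 2F = u
antidiagonal₂ o u v w 1F 1F = v
antidiagonal₂ o u v w 2F 0F = w
antidiagonal₂ o u v w _  _  = o

antidiagonal₃ : ∀ {a} {A : Set a} (o u v : A) → Fin 3 → Fin 3 → A
antidiagonal₃ o u v 1F 2F = u
antidiagonal₃ o u v 2F 1F = v
antidiagonal₃ o u v _  _  = o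

-- The rows of the weight table

module RowSums {c ℓ₁ ℓ₂} (K : HeytingField c ℓ₁ ℓ₂) where

  open HeytingField K
  open IzerginKorepin K
  open HeytingProperties heytingCommutativeRing using (x#0y#0→xy#0; x-0≈x)
  open IntegerCoefficients
    (HeytingCommutativeRing.commutativeRing heytingCommutativeRing)
  open SetoidReasoning setoid

  -- The constants 0 and 1 as polynomial expressions.
  O I : ∀ {n} → Polynomial n
  O = con (+ 0)
  I = con (+ 1)

  -- The denominators as polynomial expressions.
  E D : ∀ {n} (q x y : Polynomial n) → Polynomial n
  E q x y = x :- q :^ 2 :* y
  D q x y = (x :- q :^ 2 :* y) :* (x :- q :^ 3 :* y)

  -- The formal counterpart of ∑[ k < 3 ] ∑[ ℓ < 3 ] f k ℓ.
  ∑∑ : ∀ {n} → (Fin 3 → Fin 3 → Polynomial n) → Polynomial n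
  ∑∑ f = Vector.foldr _:+_ O {3} λ k → Vector.foldr _:+_ O {3} (f k)

  ∑-antidiagonal₁ : ∀ u v →
    ∑[ k < 3 ] ∑[ ℓ < 3 ] antidiagonal₁ 0# u v k ℓ ≈ u + v
  ∑-antidiagonal₁ = solve 2 (λ u v → ∑∑ (antidiagonal₁ O u v) := u :+ v) refl

  ∑-antidiagonal₂ : ∀ u v w →
    ∑[ k < 3 ] ∑[ ℓ < 3 ] antidiagonal₂ 0# u v w k ℓ ≈ u + v + w
  ∑-antidiagonal₂ = solve 3 (λ u v w → ∑∑ (antidiagonal₂ O u v w) := u :+ v :+ w) refl

  ∑-antidiagonal₃ : ∀ u v →
    ∑[ k < 3 ] ∑[ ℓ < 3 ] antidiagonal₃ 0# u v k ℓ ≈ u + v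
  ∑-antidiagonal₃ = solve 2 (λ u v → ∑∑ (antidiagonal₃ O u v) := u :+ v) refl

  d/d≈1 : ∀ {d} (d#0 : d # 0#) → d / (d , d#0) ≈ 1#
  d/d≈1 {d} d#0 = begin
    d * d⁻¹          ≈⟨ *-congʳ (x-0≈x d) ⟨
    (d - 0#) * d⁻¹   ≈⟨ proj₂ (proj₂ (#⇒invertible d#0)) ⟩
    1#               ∎
    where d⁻¹ = proj₁ (#⇒invertible d#0)

  module _ (q x y : Carrier)
           (x-q²y#0 : x - q ^ 2 * y # 0#) (x-q³y#0 : x - q ^ 3 * y # 0#) where

    private
      D#0 : (x - q ^ 2 * y) * (x - q ^ 3 * y) # 0#
      D#0 = x#0y#0→xy#0 x-q²y#0 x-q³y#0

      E⁻¹ D⁻¹ : Carrier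
      E⁻¹ = proj₁ (#⇒invertible x-q²y#0)
      D⁻¹ = proj₁ (#⇒invertible D#0)

    -- The two terms of the rows (0,1) and (1,2).
    terms₀₁ : (x - y) * E⁻¹ + (1# - q ^ 2) * y * E⁻¹ ≈ 1#
    terms₀₁ = trans
      (solve 4 (λ q x y t →
          (x :- y) :* t :+ (I :- q :^ 2) :* y :* t
        := E q x y :* t) refl q x y E⁻¹)
      (d/d≈1 x-q²y#0)

    -- The two terms of the rows (1,0) and (2,1).
    terms₁₀ : (1# - q ^ 2) * x * E⁻¹ + q ^ 2 * (x - y) * E⁻¹ ≈ 1#
    terms₁₀ = trans
      (solve 4 (λ q x y t →
          (I :- q :^ 2) :* x :* t :+ q :^ 2 :* (x :- y) :* t
        := E q x y :* t) refl q x y E⁻¹)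
      (d/d≈1 x-q²y#0)

    -- For fixed i and j both double sums unfold to the same nine-term
    -- expression, so the antidiagonal lemmas apply to W by computation.
    -- In the rows with i + j = 2 the solver checks that the three terms, with t
    -- for the inverse of D, add up to D * t; they are listed by increasing k.
    ∑W≈1 : ∀ i j → ∑[ k < 3 ] ∑[ ℓ < 3 ] W q x y x-q²y#0 x-q³y#0 i j k ℓ ≈ 1#
    ∑W≈1 0F 0F = solve 0 (∑∑ (λ { 0F 0F → I ; _ _ → O }) := I) refl
    ∑W≈1 2F 2F = solve 0 (∑∑ (λ { 2F 2F → I ; _ _ → O }) := I) refl
    ∑W≈1 0F 1F = trans (∑-antidiagonal₁ _ _) terms₀₁
    ∑W≈1 1F 0F = trans (∑-antidiagonal₁ _ _) terms₁₀
    ∑W≈1 1F 2F = trans (∑-antidiagonal₃ _ _) terms₀₁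
    ∑W≈1 2F 1F = trans (∑-antidiagonal₃ _ _) terms₁₀
    ∑W≈1 0F 2F = begin
      _          ≈⟨ ∑-antidiagonal₂ _ _ _ ⟩
      _          ≈⟨ solve 4 (λ q x y t →
                        (x :- y) :* (x :- q :* y) :* t
                     :+ q :* (I :- q) :^ 2 :* (I :+ q) :* (x :- y) :* y :* t
                     :+ (I :- q :^ 2)
                          :* (x :+ q :^ 2 :* x :- q :^ 2 :* y :- q :^ 3 :* y)
                          :* y :* t
                     := D q x y :* t) refl q x y D⁻¹ ⟩
      _ * D⁻¹    ≈⟨ d/d≈1 D#0 ⟩
      1#         ∎
    ∑W≈1 1F 1F = begin
      _          ≈⟨ ∑-antidiagonal₂ _ _ _ ⟩
      _          ≈⟨ solve 4 (λ q x y t →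
                        (I :+ q) :* x :* (x :- y) :* t
                     :+ (:- (q :* x :^ 2)
                          :+ (I :+ q) :* (I :- q :^ 2 :+ q :^ 4) :* x :* y
                          :- q :^ 4 :* y :^ 2) :* t
                     :- q :^ 4 :* (I :+ q) :* (x :- y) :* y :* t
                     := D q x y :* t) refl q x y D⁻¹ ⟩
      _ * D⁻¹    ≈⟨ d/d≈1 D#0 ⟩
      1#         ∎
    ∑W≈1 2F 0F = begin
      _          ≈⟨ ∑-antidiagonal₂ _ _ _ ⟩
      _          ≈⟨ solve 4 (λ q x y t →
                        (I :- q :^ 2) :* x
                          :* (x :+ q :* x :- q :* y :- q :^ 3 :* y) :* t
                     :- q :* (I :- q) :^ 2 :* (I :+ q) :* x :* (x :- y) :* t
                     :+ q :^ 4 :* (x :- y) :* (x :- q :* y) :* t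
                     := D q x y :* t) refl q x y D⁻¹ ⟩
      _ * D⁻¹    ≈⟨ d/d≈1 D#0 ⟩
      1#         ∎

proposition3p1p4 : ∀ {c ℓ₁ ℓ₂} (K : HeytingField c ℓ₁ ℓ₂) →
    let open HeytingField K
        open IzerginKorepin K in
    (q x y : Carrier)
    (x-q²y#0 : x - q ^ 2 * y # 0#) (x-q³y#0 : x - q ^ 3 * y # 0#)
    (i j : Fin 3) →
    ∑[ k < 3 ] ∑[ ℓ < 3 ] W q x y x-q²y#0 x-q³y#0 i j k ℓ ≈ 1#
proposition3p1p4 K = RowSums.∑W≈1 K
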